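{- Let $s,t$ be two integers and let $k$ be a positive integer. Let $F_1$ be a graph of order $s$, and suppose there is an integer $a\geq 1$ and graphs $F_1,F_2,\ldots,F_a$ such that for each $2\leq i\leq a$ the graph $F_i$ is obtained from $F_{i-1}$ by deleting all leaves of $F_{i-1}$, and such that $F_a$ has no leaves. Let $r$ be the total number of edges deleted in passing from $F_1$ to $F_a$. If $\Delta(F_a)=d\geq 2$, $e(F_1)=b$ and $b\leq 2d^2(s-r)+32d^4$, then $$\operatorname{gr}_k(F_1,K_t)\leq (2d^2(s-r)+32d^4)^{kt}+4(s-r)\,\frac{(2d^2(s-r)+32d^4)^{kt}-1}{2d^2(s-r)+32d^4-1}.$$
   Context: The order of a graph is its number of vertices; $e(F)$ denotes the number of edges and $\Delta(F)$ the maximum degree of $F$; a leaf is a vertex of degree one. A $k$-edge-coloring of $K_n$ assigns to each edge one of $k$ colors (not all colors need be used, and it need not be proper). A subgraph is rainbow if all its edges have distinct colors, and monochromatic if all its edges have the same color. For graphs $G,H$ and a positive integer $k$, the Gallai-Ramsey number $\operatorname{gr}_k(G,H)$ is the minimum integer $n$ such that every $k$-edge-coloring of the complete graph $K_n$ contains a rainbow copy of $G$ or a monochromatic copy of $H$. -}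

module Defs where

open import Data.Nat using (ℕ; _+_; _*_; _∸_; _^_; _≤_; NonZero; >-nonZero)
open import Data.Nat.Properties using (^-monoˡ-≤; *-monoʳ-≤; ∸-monoˡ-≤; m≤n+m; ≤-trans; m≤m+n)
open import Data.Fin using (Fin)
open import Data.Fin.Properties using (_≟_; _<?_)
open import Data.List using (length; filter; map; allFin; cartesianProduct)
open import Data.List.Extrema.Nat using (max)
open import Data.Product using (∃; _×_; _,_)
open import Data.Sum using (_⊎_)
open import Function.Bundles using (_⇔_)
open import Function.Definitions using (Injective)
open import Level using (0ℓ)
open import Relation.Binary.Core using (Rel)
open import Relation.Binary.Definitions using (Symmetric; Decidable)
open import Relation.Binary.PropositionalEquality using (_≡_; _≢_; refl; ≢-sym)
open import Relation.Nullary using (¬_)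
open import Relation.Nullary.Decidable using (_×-dec_; ¬?)

-- Finite simple graphs.
record Graph : Set₁ where
  infix 4 _~_ _~?_
  field
    order  : ℕ
    _~_    : Rel (Fin order) 0ℓ
    _~?_   : Decidable _~_
    ~-sym  : Symmetric _~_
    ~-irrefl : ∀ {v} → ¬ (v ~ v)

  Vertex : Set
  Vertex = Fin order

  degree : Vertex → ℕ
  degree v = length (filter (v ~?_) (allFin order))

  -- Each edge {u , v} is counted once, as the pair with u < v.
  edgeCount : ℕ
  edgeCount = length (filter (λ (u , v) → (u <? v) ×-dec (u ~? v))
                             (cartesianProduct (allFin order) (allFin order)))

  maxDegree : ℕ
  maxDegree = max 0 (map degree (allFin order))

  Leaf : Vertex → Set
  Leaf v = degree v ≡ 1

  Leafless : Set
  Leafless = ∀ v → ¬ Leaf v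

open Graph public using (order; Vertex; edgeCount; maxDegree; Leaf; Leafless)

K : ℕ → Graph
K t = record
  { order    = t
  ; _~_      = _≢_
  ; _~?_     = λ u v → ¬? (u ≟ v)
  ; ~-sym    = ≢-sym
  ; ~-irrefl = λ v≢v → v≢v refl
  }

-- H is, up to isomorphism, the subgraph of G induced on the non-leaves of G.
-- All leaves of G go simultaneously (so both ends of a K₂ component do);
-- isolated vertices stay.
record DeletesAllLeaves (G H : Graph) : Set where
  field
    embed     : Vertex H → Vertex G
    injective : Injective _≡_ _≡_ embed
    adjacency : ∀ u v → Graph._~_ H u v ⇔ Graph._~_ G (embed u) (embed v)
    image     : ∀ v → (∃ λ u → embed u ≡ v) ⇔ (¬ Leaf G v)

-- Edge colourings of the complete graph on Fin n; the values on the diagonal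
-- are never inspected.
record EdgeColouring (k n : ℕ) : Set where
  field
    colour     : Fin n → Fin n → Fin k
    colour-sym : ∀ u v → colour u v ≡ colour v u

-- Every injection of the vertices of G into Fin n gives a copy of G in the
-- complete graph, so a copy is just such an injection.
module _ {k n : ℕ} (c : EdgeColouring k n) (G : Graph) where
  open EdgeColouring c
  open Graph G using (_~_)

  record RainbowCopy : Set where
    field
      embed     : Vertex G → Fin n
      injective : Injective _≡_ _≡_ embed
      rainbow   : ∀ {u v x y} → u ~ v → x ~ y →
                  colour (embed u) (embed v) ≡ colour (embed x) (embed y) →
                  (u ≡ x × v ≡ y) ⊎ (u ≡ y × v ≡ x)

  record MonochromaticCopy : Set where
    field
      embed         : Vertex G → Fin n
      injective     : Injective _≡_ _≡_ embed
      monochromatic : ∀ {u v x y} → u ~ v → x ~ y →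
                      colour (embed u) (embed v) ≡ colour (embed x) (embed y)

Unavoidable : ℕ → Graph → Graph → ℕ → Set
Unavoidable k G H n =
  (c : EdgeColouring k n) → RainbowCopy c G ⊎ MonochromaticCopy c H

-- n = gr_k(G , H).
record IsGallaiRamsey (k : ℕ) (G H : Graph) (n : ℕ) : Set where
  field
    unavoidable : Unavoidable k G H n
    least       : ∀ m → Unavoidable k G H m → n ≤ m

-- With x = s - r this is the quantity 2d²(s - r) + 32d⁴.  Truncated
-- subtraction is harmless in s ∸ r: deleting leaves never removes more edges
-- than vertices, so r ≤ s.  For q = base d x, the natural-number quotient
-- (q ^ m ∸ 1) / (q ∸ 1) is exact, being 1 + q + ⋯ + q ^ (m ∸ 1).
base : ℕ → ℕ → ℕ
base d x = 2 * d ^ 2 * x + 32 * d ^ 4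

base∸1-nonZero : ∀ {d} x → 2 ≤ d → NonZero (base d x ∸ 1)
base∸1-nonZero {d} x 2≤d = >-nonZero (∸-monoˡ-≤ 1 2≤base)
  where
  2≤base : 2 ≤ base d x
  2≤base = ≤-trans (m≤m+n 2 510)
             (≤-trans (*-monoʳ-≤ 32 (^-monoˡ-≤ 4 2≤d))
                      (m≤n+m (32 * d ^ 4) (2 * d ^ 2 * x)))

module Submission where

-- Put q = base d (s ∸ r), x = s ∸ r and N (m + 1) = q N m + 4 x, N 0 = 1; the
-- bound is N (k t). If some vertex of the complete graph on N (m + 1) points
-- has N m neighbours in one colour, restrict to them and ask for a smaller
-- clique in that colour. Otherwise all monochromatic degrees are at most
-- Δ = N m ∸ 1, and a rainbow copy of F 1 is found greedily. For F a the danger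
-- is a new point joined by one colour to two placed neighbours; call a pair bad
-- if it has many such points. Counting monochromatic cherries with a fixed end
-- shows that every point is in few bad pairs, so bad pairs can be avoided at
-- distance two. Deleted leaves are then put back one at a time, each needing
-- only one edge of a new colour; this is where b ≤ q enters. Finally F a has
-- at most s ∸ r vertices, since distinct deleted edges are charged to distinct
-- deleted leaves.

open import Data.Fin using (Fin; zero; suc; inject≤; fromℕ<) renaming (_<_ to _<ᶠ_)
open import Data.Fin.Properties using (_≟_; _<?_; <-cmp; <-asym; any?; all?; inject≤-injective)
open import Data.List using (List; []; _∷_; [_]; _++_; length; lookup; map; filter; concatMap; cartesianProduct; allFin)
open import Data.List.Extrema.Nat using (xs≤max; max≤v⁺)
open import Data.List.Membership.Propositional using (_∈_; _∉_; lose)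
open import Data.List.Membership.Propositional.Properties
open import Data.List.Properties using (length-++; length-++-sucʳ; length-map; length-tabulate; length-filter; filter-≐)
open import Data.List.Relation.Binary.Subset.Propositional using (_⊆_)
open import Data.List.Relation.Unary.All as All using (All; []; _∷_)
open import Data.List.Relation.Unary.AllPairs using ([]; _∷_)
open import Data.List.Relation.Unary.Any using (here; there)
open import Data.List.Relation.Unary.Unique.Propositional using (Unique)
open import Data.Nat using (ℕ; zero; suc; _+_; _*_; _∸_; _^_; _/_; _≤_; _<_; _≤?_; z≤n; s≤s; NonZero; >-nonZero) renaming (_≟_ to _≟ℕ_)
open import Data.Nat.DivMod using (m*n/n≡m; /-congˡ)
open import Data.Nat.Properties hiding (_≟_; _<?_; _≤?_; <-cmp; <-asym)
open import Data.Nat.Tactic.RingSolver using (solve-∀)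
open import Data.Product using (∃; ∃₂; _×_; _,_; proj₁; proj₂; swap)
open import Data.Sum as Sum using (_⊎_; inj₁; inj₂; [_,_]′)
open import Data.Vec using (Vec; []; _∷_; replicate; sum) renaming (lookup to lookupᵛ; updateAt to updateAtᵛ)
open import Data.Vec.Functional using (updateAt)
open import Data.Vec.Functional.Properties using (updateAt-updates; updateAt-minimal)
open import Data.Vec.Properties using (lookup∘updateAt; lookup∘updateAt′; lookup-replicate)
open import Function using (_∘_; id; const)
open import Function.Bundles using (module Equivalence)
open import Function.Definitions using (Injective)
open import Level using (0ℓ)
open import Relation.Binary.Construct.Closure.ReflexiveTransitive using (Star; ε; _◅_; _◅◅_)
open import Relation.Binary.Core using (Rel)
open import Relation.Binary.Definitions using (tri<; tri≈; tri>)
open import Relation.Binary.PropositionalEquality hiding ([_])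
open import Relation.Nullary using (¬_; Dec; yes; no; contradiction)
open import Relation.Nullary.Decidable using (_×-dec_; _⊎-dec_; _→-dec_; ¬?; map′; decidable-stable)
open import Relation.Unary using () renaming (Decidable to Decidable₁)
import Data.List.Membership.DecPropositional as DecMembership
import Data.List.Relation.Unary.Unique.Propositional.Properties as Unique
open import Algebra.Properties.CommutativeSemigroup +-commutativeSemigroup using (x∙yz≈y∙xz)
open import Defs

-- Counting in finite lists

module _ {A B : Set} (f : A → B) where

  -- Induction on `xs`, cutting one occurrence of `f x` out of `ys`. The values at the remaining
  -- elements survive the cut, since injectivity on `xs` keeps them apart from `f x`.
  length-injectiveOn : ∀ {xs ys} → Unique xs →
    (∀ {x} → x ∈ xs → f x ∈ ys) →
    (∀ {x y} → x ∈ xs → y ∈ xs → f x ≡ f y → x ≡ y) →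
    length xs ≤ length ys
  length-injectiveOn {[]} _ _ _ = z≤n
  length-injectiveOn {x ∷ xs} (x≢xs ∷ uniq) into inj
    with ∈-∃++ (into (here refl))
  ... | as , bs , refl = begin
    suc (length xs)          ≤⟨ s≤s (length-injectiveOn uniq into′ λ p q → inj (there p) (there q)) ⟩
    suc (length (as ++ bs))  ≡⟨ length-++-sucʳ as (f x) bs ⟨
    length (as ++ [ f x ] ++ bs) ∎
    where
    open ≤-Reasoning
    into′ : ∀ {y} → y ∈ xs → f y ∈ as ++ bs
    into′ y∈xs with ∈-++⁻ as (into (there y∈xs))
    ... | inj₁ p = ∈-++⁺ˡ p
    ... | inj₂ (there p) = ∈-++⁺ʳ as p
    ... | inj₂ (here eq) =
      contradiction (inj (here refl) (there y∈xs) (sym eq)) (All.lookup x≢xs y∈xs)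

length-⊆ : ∀ {A : Set} {xs ys : List A} → Unique xs →
           (∀ {x} → x ∈ xs → x ∈ ys) → length xs ≤ length ys
length-⊆ uniq sub = length-injectiveOn id uniq sub (λ _ _ → id)

length-allFin : ∀ n → length (allFin n) ≡ n
length-allFin n = length-tabulate id

length-++-≤ : ∀ {A : Set} (xs : List A) {ys i j} →
  length xs ≤ i → length ys ≤ j → length (xs ++ ys) ≤ i + j
length-++-≤ xs p q = ≤-trans (≤-reflexive (length-++ xs)) (+-mono-≤ p q)

length-concatMap-≤ : ∀ {A B : Set} (f : A → List B) xs {N i} → length xs ≤ i →
  (∀ x → length (f x) ≤ N) → length (concatMap f xs) ≤ i * N
length-concatMap-≤ {A} {B} f xs {N} {i} len bound = ≤-trans (go xs) (*-monoˡ-≤ N len)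
  where
  go : ∀ xs → length (concatMap f xs) ≤ length xs * N
  go [] = z≤n
  go (x ∷ xs) = length-++-≤ (f x) (bound x) (go xs)

∈-concatMap : ∀ {A B : Set} (f : A → List B) {x xs y} → x ∈ xs → y ∈ f x → y ∈ concatMap f xs
∈-concatMap f x∈xs y∈fx = ∈-concatMap⁺ f (lose x∈xs y∈fx)

-- Pigeonhole; each greedy choice applies it with `xs` the list of forbidden points.
fresh : ∀ {n} (xs : List (Fin n)) → length xs < n → ∃ λ w → w ∉ xs
fresh {n} xs short with any? (λ w → ¬? (DecMembership._∈?_ _≟_ w xs))
... | yes found = found
... | no none = contradiction short (≤⇒≯ (begin
    n                  ≡⟨ length-allFin n ⟨
    length (allFin n)  ≤⟨ length-⊆ (Unique.allFin⁺ n) (λ {w} _ →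
                            decidable-stable (DecMembership._∈?_ _≟_ w xs) (λ w∉ → none (w , w∉))) ⟩
    length xs          ∎))
  where open ≤-Reasoning

module _ {A B : Set} {R : A → B → Set} (R? : ∀ x y → Dec (R x y)) where

  private
    row : List B → A → ℕ
    row ys x = length (filter (R? x) ys)

    column : List A → B → ℕ
    column xs y = length (filter (λ x → R? x y) xs)

  -- Exchange of summation: the related pairs are counted by rows and then by columns.
  double-count : ∀ {M N} xs ys → (∀ {x} → x ∈ xs → M ≤ length (filter (R? x) ys)) →
    (∀ y → length (filter (λ x → R? x y) xs) ≤ N) → length xs * M ≤ length ys * N
  double-count {M} {N} xs ys rows columns = begin
    length xs * M           ≤⟨ rows-≤ xs rows ⟩
    total (row ys) xs       ≡⟨ exchange xs ys ⟩
    total (column xs) ys    ≤⟨ columns-≤ ys ⟩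
    length ys * N           ∎
    where
    open ≤-Reasoning
    total : ∀ {C : Set} → (C → ℕ) → List C → ℕ
    total f []       = 0
    total f (c ∷ cs) = f c + total f cs

    rows-≤ : ∀ xs → (∀ {x} → x ∈ xs → M ≤ row ys x) → length xs * M ≤ total (row ys) xs
    rows-≤ [] _ = z≤n
    rows-≤ (x ∷ xs) p = +-mono-≤ (p (here refl)) (rows-≤ xs (p ∘ there))

    columns-≤ : ∀ ys → total (column xs) ys ≤ length ys * N
    columns-≤ [] = z≤n
    columns-≤ (y ∷ ys) = +-mono-≤ (columns y) (columns-≤ ys)

    empty : ∀ (ys : List B) → 0 ≡ total (column []) ys
    empty [] = refl
    empty (y ∷ ys) = empty ys

    cons : ∀ x xs ys → row ys x + total (column xs) ys ≡ total (column (x ∷ xs)) ys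
    cons x xs [] = refl
    cons x xs (y ∷ ys) with R? x y
    ... | yes _ = cong suc (begin-equality
      row ys x + (column xs y + total (column xs) ys)   ≡⟨ x∙yz≈y∙xz (row ys x) (column xs y) _ ⟩
      column xs y + (row ys x + total (column xs) ys)   ≡⟨ cong (column xs y +_) (cons x xs ys) ⟩
      column xs y + total (column (x ∷ xs)) ys          ∎)
    ... | no _ = begin-equality
      row ys x + (column xs y + total (column xs) ys)   ≡⟨ x∙yz≈y∙xz (row ys x) (column xs y) _ ⟩
      column xs y + (row ys x + total (column xs) ys)   ≡⟨ cong (column xs y +_) (cons x xs ys) ⟩
      column xs y + total (column (x ∷ xs)) ys          ∎

    exchange : ∀ xs ys → total (row ys) xs ≡ total (column xs) ys
    exchange [] ys = empty ys
    exchange (x ∷ xs) ys = trans (cong (row ys x +_) (exchange xs ys)) (cons x xs ys)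

-- Finite search and decidability of Unavoidable

-- `P` has to respect `_≈_`: without function extensionality, functions can be exhausted only up to
-- pointwise equality.
Searchable : (A : Set) → Rel A 0ℓ → Set₁
Searchable A _≈_ = ∀ {P : A → Set} → Decidable₁ P → (∀ {x y} → x ≈ y → P x → P y) → Dec (∃ P)

Fin-searchable : ∀ n → Searchable (Fin n) _≡_
Fin-searchable n P? _ = any? P?

infixr 5 _◂_
_◂_ : ∀ {A : Set} {m} → A → (Fin m → A) → Fin (suc m) → A
(a ◂ f) zero    = a
(a ◂ f) (suc i) = f i

-- Searches for the value at `zero`, then for the other values. A function agrees with its
-- reassembly by `_◂_` only pointwise, and `resp` bridges that gap.
→-searchable : ∀ {A : Set} {_≈_ : Rel A 0ℓ} m → (∀ {x} → x ≈ x) → Searchable A _≈_ →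
               Searchable (Fin m → A) (λ f g → ∀ i → f i ≈ g i)
→-searchable zero _ _ {P} P? resp =
  map′ (_ ,_) (λ { (f , p) → resp (λ ()) p }) (P? (λ ()))
→-searchable {A} {_≈_} (suc m) ≈-refl search {P} P? resp =
  map′ (λ { (a , f , p) → (a ◂ f) , p })
       (λ { (f , p) → f zero , f ∘ suc , resp (λ { zero → ≈-refl ; (suc i) → ≈-refl }) p })
       (search (λ a → →-searchable m ≈-refl search (P? ∘ (a ◂_))
                 (λ f≈g → resp λ { zero → ≈-refl ; (suc i) → f≈g i }))
               (λ { x≈y (f , p) → f , resp (λ { zero → x≈y ; (suc i) → ≈-refl }) p }))

-- Turns an upper bound into the Gallai-Ramsey number itself: decidability yields a minimum
-- constructively, and the known witness `N` bounds the search.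
least-witness : ∀ {P : ℕ → Set} → Decidable₁ P → ∀ N → P N →
                ∃ λ n → P n × (∀ m → P m → n ≤ m) × n ≤ N
least-witness P? zero pN = 0 , pN , (λ _ _ → z≤n) , z≤n
least-witness {P} P? (suc N) pN with P? 0
... | yes p0 = 0 , p0 , (λ _ _ → z≤n) , z≤n
... | no ¬p0 with least-witness (P? ∘ suc) N pN
... | n , pn , min , n≤N = suc n , pn , min′ , s≤s n≤N
  where
  min′ : ∀ m → P m → suc n ≤ m
  min′ zero    p = contradiction p ¬p0
  min′ (suc m) p = s≤s (min m p)

injective? : ∀ {m n} (f : Fin m → Fin n) → Dec (∀ u v → f u ≡ f v → u ≡ v)
injective? f = all? λ u → all? λ v → (f u ≟ f v) →-dec (u ≟ v)

module _ {k n : ℕ} (c : EdgeColouring k n) (G : Graph) where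
  open EdgeColouring c
  open Graph G using (_~_; _~?_)

  private
    functions : Searchable (Vertex G → Fin n) _≗_
    functions = →-searchable (order G) refl (Fin-searchable n)

    colour-resp : ∀ {f g : Vertex G → Fin n} → f ≗ g → ∀ u v →
                  colour (g u) (g v) ≡ colour (f u) (f v)
    colour-resp f≗g u v = sym (cong₂ colour (f≗g u) (f≗g v))

    IsRainbow IsMonochromatic : (Vertex G → Fin n) → Set
    IsRainbow f = (∀ u v → f u ≡ f v → u ≡ v) ×
      (∀ u v x y → u ~ v → x ~ y → colour (f u) (f v) ≡ colour (f x) (f y) →
       (u ≡ x × v ≡ y) ⊎ (u ≡ y × v ≡ x))
    IsMonochromatic f = (∀ u v → f u ≡ f v → u ≡ v) ×
      (∀ u v x y → u ~ v → x ~ y → colour (f u) (f v) ≡ colour (f x) (f y))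

  rainbowCopy? : Dec (RainbowCopy c G)
  rainbowCopy? = map′
    (λ { (f , inj , rb) → record { embed = f ; injective = inj _ _ ; rainbow = rb _ _ _ _ } })
    (λ r → let open RainbowCopy r in
           embed , (λ _ _ → injective) , (λ _ _ _ _ → rainbow))
    (functions {IsRainbow}
      (λ f → injective? f ×-dec
        all? λ u → all? λ v → all? λ x → all? λ y → (u ~? v) →-dec ((x ~? y) →-dec
          ((colour (f u) (f v) ≟ colour (f x) (f y)) →-dec
            (((u ≟ x) ×-dec (v ≟ y)) ⊎-dec ((u ≟ y) ×-dec (v ≟ x))))))
      (λ f≗g (inj , rb) →
        (λ u v eq → inj u v (trans (f≗g u) (trans eq (sym (f≗g v))))) ,
        (λ u v x y u~v x~y eq → rb u v x y u~v x~y
          (trans (sym (colour-resp f≗g u v)) (trans eq (colour-resp f≗g x y))))))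

  monochromaticCopy? : Dec (MonochromaticCopy c G)
  monochromaticCopy? = map′
    (λ { (f , inj , mc) → record { embed = f ; injective = inj _ _ ; monochromatic = mc _ _ _ _ } })
    (λ r → let open MonochromaticCopy r in
           embed , (λ _ _ → injective) , (λ _ _ _ _ → monochromatic))
    (functions {IsMonochromatic}
      (λ f → injective? f ×-dec
        all? λ u → all? λ v → all? λ x → all? λ y → (u ~? v) →-dec ((x ~? y) →-dec
          (colour (f u) (f v) ≟ colour (f x) (f y))))
      (λ f≗g (inj , mc) →
        (λ u v eq → inj u v (trans (f≗g u) (trans eq (sym (f≗g v))))) ,
        (λ u v x y u~v x~y →
          trans (colour-resp f≗g u v) (trans (mc u v x y u~v x~y) (sym (colour-resp f≗g x y))))))

module _ {k m n : ℕ} {c : EdgeColouring k m} {c′ : EdgeColouring k n} (ι : Fin m → Fin n)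
         (ι-injective : Injective _≡_ _≡_ ι)
         (ι-colour : ∀ u v → EdgeColouring.colour c′ (ι u) (ι v) ≡ EdgeColouring.colour c u v)
         {G : Graph} where

  transport-rainbow : RainbowCopy c G → RainbowCopy c′ G
  transport-rainbow r = record
    { embed = ι ∘ embed
    ; injective = injective ∘ ι-injective
    ; rainbow = λ u~v x~y eq → rainbow u~v x~y (trans (sym (ι-colour _ _)) (trans eq (ι-colour _ _)))
    }
    where open RainbowCopy r

  transport-monochromatic : MonochromaticCopy c G → MonochromaticCopy c′ G
  transport-monochromatic r = record
    { embed = ι ∘ embed
    ; injective = injective ∘ ι-injective
    ; monochromatic = λ u~v x~y → trans (ι-colour _ _) (trans (monochromatic u~v x~y) (sym (ι-colour _ _)))
    }
    where open MonochromaticCopy r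

module _ (k : ℕ) (G H : Graph) (n : ℕ) where

  private
    IsSymmetric : (Fin n → Fin n → Fin k) → Set
    IsSymmetric f = ∀ u v → f u v ≡ f v u

    colouring : ∀ f → IsSymmetric f → EdgeColouring k n
    colouring f s = record { colour = f ; colour-sym = s }

    -- Symmetry is part of the property, so that the search can range over all functions.
    Avoids : (Fin n → Fin n → Fin k) → Set
    Avoids f = ∃ λ (s : IsSymmetric f) →
      ¬ (RainbowCopy (colouring f s) G ⊎ MonochromaticCopy (colouring f s) H)

    Avoids-resp : ∀ {f g} → (∀ u v → f u v ≡ g u v) → Avoids f → Avoids g
    Avoids-resp f≗g (s , none) =
      (λ u v → trans (sym (f≗g u v)) (trans (s u v) (f≗g v u))) ,
      none ∘ Sum.map (transport-rainbow id id f≗g) (transport-monochromatic id id f≗g)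

    avoids? : Decidable₁ Avoids
    avoids? f with all? (λ u → all? λ v → f u v ≟ f v u)
    ... | no ¬s = no (¬s ∘ proj₁)
    ... | yes s with rainbowCopy? (colouring f s) G ⊎-dec monochromaticCopy? (colouring f s) H
    ...   | no none = yes (s , none)
    -- The proofs of symmetry `s` and `s′` may differ, but the colours agree, so the copy is
    -- transported along the identity.
    ...   | yes copy = no λ (s′ , none) → none (Sum.map
              (transport-rainbow id id (λ _ _ → refl))
              (transport-monochromatic id id (λ _ _ → refl)) copy)

  -- An exhaustive search for a counterexample; if there is none, decidability of both kinds of copy
  -- removes the double negation.
  unavoidable? : Dec (Unavoidable k G H n)
  unavoidable? with →-searchable n (λ _ → refl) (→-searchable n refl (Fin-searchable k)) avoids? Avoids-resp
  ... | yes (f , s , none) = no λ unav → none (unav (colouring f s))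
  ... | no none = yes λ c → decidable-stable (rainbowCopy? c G ⊎-dec monochromaticCopy? c H)
          (λ ¬copy → none (EdgeColouring.colour c , EdgeColouring.colour-sym c , ¬copy))

-- Ramsey recursion

module _ {k n : ℕ} (c : EdgeColouring k n) where
  open EdgeColouring c

  -- The point `p` is left out because `colour p p` is arbitrary.
  neighbours : Fin n → Fin k → List (Fin n)
  neighbours p i = filter (λ w → ¬? (w ≟ p) ×-dec (colour p w ≟ i)) (allFin n)

  restrict : ∀ {m} → (Fin m → Fin n) → EdgeColouring k m
  restrict ι = record { colour = λ u v → colour (ι u) (ι v) ; colour-sym = λ u v → colour-sym (ι u) (ι v) }

  -- Unlike in `MonochromaticCopy` the colour is named: the recursion keeps track of it, and for
  -- `t ≤ 1` no edge would determine it.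
  record Clique (i : Fin k) (t : ℕ) : Set where
    field
      embed     : Fin t → Fin n
      injective : Injective _≡_ _≡_ embed
      coloured  : ∀ {u v} → u ≢ v → colour (embed u) (embed v) ≡ i

Clique⇒MonochromaticCopy : ∀ {k n i t} {c : EdgeColouring k n} → Clique c i t → MonochromaticCopy c (K t)
Clique⇒MonochromaticCopy q = record
  { embed = embed ; injective = injective
  ; monochromatic = λ u≢v x≢y → trans (coloured u≢v) (sym (coloured x≢y)) }
  where open Clique q

Clique-0 : ∀ {k n i} {c : EdgeColouring k n} → Clique c i 0
Clique-0 = record { embed = λ () ; injective = λ { {()} } ; coloured = λ { {()} } }

module _ {k m n : ℕ} {c : EdgeColouring k n} (ι : Fin m → Fin n)
         (ι-injective : Injective _≡_ _≡_ ι) where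
  open EdgeColouring c

  Clique-unrestrict : ∀ {i t} → Clique (restrict c ι) i t → Clique c i t
  Clique-unrestrict q = record
    { embed = ι ∘ embed ; injective = injective ∘ ι-injective ; coloured = coloured }
    where open Clique q

  Clique-cone : ∀ {i t p} → (∀ u → ι u ∈ neighbours c p i) →
                Clique (restrict c ι) i t → Clique c i (suc t)
  Clique-cone {i} {t} {p} ι∈ q = record { embed = embed′ ; injective = injective′ _ _ ; coloured = coloured′ _ _ }
    where
    open Clique q
    embed′ : Fin (suc t) → Fin n
    embed′ = p ◂ (ι ∘ embed)

    adjacent : ∀ u → ι u ≢ p × colour p (ι u) ≡ i
    adjacent u = proj₂ (∈-filter⁻ _ {xs = allFin n} (ι∈ u))

    injective′ : ∀ u v → embed′ u ≡ embed′ v → u ≡ v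
    injective′ zero    zero    _  = refl
    injective′ zero    (suc v) eq = contradiction (sym eq) (proj₁ (adjacent _))
    injective′ (suc u) zero    eq = contradiction eq (proj₁ (adjacent _))
    injective′ (suc u) (suc v) eq = cong suc (injective (ι-injective eq))

    coloured′ : ∀ u v → u ≢ v → colour (embed′ u) (embed′ v) ≡ i
    coloured′ zero    zero    u≢v = contradiction refl u≢v
    coloured′ zero    (suc v) _   = proj₂ (adjacent _)
    coloured′ (suc u) zero    _   = trans (colour-sym _ _) (proj₂ (adjacent _))
    coloured′ (suc u) (suc v) u≢v = coloured (u≢v ∘ cong suc)

lookup-injective : ∀ {A : Set} {xs : List A} → Unique xs → Injective _≡_ _≡_ (lookup xs)
lookup-injective (_ ∷ _)     {zero}  {zero}  _  = refl
lookup-injective (x≢ ∷ _)    {zero}  {suc j} eq = contradiction eq (All.lookup x≢ (∈-lookup j))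
lookup-injective (x≢ ∷ _)    {suc i} {zero}  eq = contradiction (sym eq) (All.lookup x≢ (∈-lookup i))
lookup-injective (_ ∷ uniq)  {suc i} {suc j} eq = cong suc (lookup-injective uniq eq)

enumerate : ∀ {A : Set} {m} (xs : List A) → Unique xs → m ≤ length xs →
            ∃ λ (ι : Fin m → A) → Injective _≡_ _≡_ ι × (∀ u → ι u ∈ xs)
enumerate xs uniq m≤ =
  (λ u → lookup xs (inject≤ u m≤)) ,
  (λ eq → inject≤-injective m≤ m≤ _ _ (lookup-injective uniq eq)) ,
  (λ u → ∈-lookup (inject≤ u m≤))

sum-updateAt-pred : ∀ {k t} (T : Vec ℕ k) i → lookupᵛ T i ≡ suc t →
                    suc (sum (updateAtᵛ T i (_∸ 1))) ≡ sum T
sum-updateAt-pred (_ ∷ T) zero refl = refl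
sum-updateAt-pred (x ∷ T) (suc i) eq =
  trans (sym (+-suc x _)) (cong (x +_) (sum-updateAt-pred T i eq))

lookup≤sum : ∀ {k} (T : Vec ℕ k) i → lookupᵛ T i ≤ sum T
lookup≤sum (x ∷ T) zero = m≤m+n x _
lookup≤sum (x ∷ T) (suc i) = ≤-trans (lookup≤sum T i) (m≤n+m _ x)

sum-replicate : ∀ k t → sum (replicate k t) ≡ k * t
sum-replicate zero t = refl
sum-replicate (suc k) t = cong (t +_) (sum-replicate k t)

module _ {k : ℕ} (k≥1 : 1 ≤ k) (G : Graph) (N : ℕ → ℕ)
  (sparse : ∀ m (c : EdgeColouring k (N (suc m))) →
            (∀ p i → length (neighbours c p i) < N m) → RainbowCopy c G) where

  -- `T` holds the clique size still wanted in each colour. Descending into a large neighbourhood of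
  -- colour `i` lowers entry `i` by one, hence also the sum, and `m` bounds the descents left.
  ramsey : ∀ m (T : Vec ℕ k) → sum T ≤ m → (c : EdgeColouring k (N m)) →
           RainbowCopy c G ⊎ ∃ λ i → Clique c i (lookupᵛ T i)
  ramsey zero T ≤0 c = inj₂ (i , subst (Clique c i) (sym (n≤0⇒n≡0 (≤-trans (lookup≤sum T i) ≤0))) Clique-0)
    where
    -- All entries of `T` are zero here, so any colour will do; `k≥1` supplies one.
    i : Fin k
    i = inject≤ zero k≥1
  ramsey (suc m) T ≤sm c
    with any? (λ p → any? λ i → N m ≤? length (neighbours c p i))
  ... | no none = inj₁ (sparse m c λ p i → ≰⇒> λ big → none (p , i , big))
  ... | yes (p , i , big) with lookupᵛ T i in Ti
  ...   | zero = inj₂ (i , subst (Clique c i) (sym Ti) Clique-0)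
  ...   | suc t with enumerate (neighbours c p i) (Unique.filter⁺ _ (Unique.allFin⁺ _)) big
  ...     | ι , ι-inj , ι∈
          with ramsey m (updateAtᵛ T i (_∸ 1))
                 (≤-pred (≤-trans (≤-reflexive (sum-updateAt-pred T i Ti)) ≤sm)) (restrict c ι)
  ...       | inj₁ r = inj₁ (transport-rainbow ι ι-inj (λ _ _ → refl) r)
  -- In colour `i` the apex `p` completes the clique; in any other colour the wanted size was left
  -- unchanged.
  ...       | inj₂ (j , q) with i ≟ j
  ...         | yes refl = inj₂ (i , subst (Clique c i) (sym Ti) (Clique-cone ι ι-inj ι∈
                             (subst (Clique _ i) (trans (lookup∘updateAt i T) (cong (_∸ 1) Ti)) q)))
  ...         | no i≢j = inj₂ (j , Clique-unrestrict ι ι-inj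
                             (subst (Clique _ j) (lookup∘updateAt′ j i (i≢j ∘ sym) T) q))

  ramsey-unavoidable : ∀ t → Unavoidable k G (K t) (N (k * t))
  ramsey-unavoidable t c with ramsey (k * t) (replicate k t) (≤-reflexive (sum-replicate k t)) c
  ... | inj₁ r = inj₁ r
  ... | inj₂ (i , q) = inj₂ (Clique⇒MonochromaticCopy (subst (Clique c i) (lookup-replicate i t) q))

-- Greedy rainbow embeddings

module _ (G : Graph) where
  open Graph G using (_~_; _~?_; ~-sym; ~-irrefl; degree)

  adjacents : Vertex G → List (Vertex G)
  adjacents v = filter (v ~?_) (allFin (order G))

  edges : List (Vertex G × Vertex G)
  edges = filter (λ (u , v) → (u <? v) ×-dec (u ~? v))
                 (cartesianProduct (allFin (order G)) (allFin (order G)))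

  ∈-adjacents : ∀ {v u} → v ~ u → u ∈ adjacents v
  ∈-adjacents {u = u} = ∈-filter⁺ _ (∈-allFin u)

  edges-adjacent : ∀ {u v} → (u , v) ∈ edges → u ~ v
  edges-adjacent = proj₂ ∘ proj₂ ∘ ∈-filter⁻ _ {xs = cartesianProduct (allFin (order G)) _}

  ∈-edges : ∀ {u v} → u ~ v → (u , v) ∈ edges ⊎ (v , u) ∈ edges
  ∈-edges {u} {v} u~v with <-cmp u v
  ... | tri< u<v _ _ = inj₁ (∈-filter⁺ _ (∈-cartesianProduct⁺ (∈-allFin u) (∈-allFin v)) (u<v , u~v))
  ... | tri> _ _ v<u = inj₂ (∈-filter⁺ _ (∈-cartesianProduct⁺ (∈-allFin v) (∈-allFin u)) (v<u , ~-sym u~v))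
  ... | tri≈ _ refl _ = contradiction u~v ~-irrefl

  edges-unique : Unique edges
  edges-unique = Unique.filter⁺ _ (Unique.cartesianProduct⁺ (Unique.allFin⁺ _) (Unique.allFin⁺ _))

  -- Each listed edge is a dart leaving its smaller end, and at most `d` darts leave a vertex.
  edgeCount-≤ : ∀ {d} → (∀ v → degree v ≤ d) → edgeCount G ≤ order G * d
  edgeCount-≤ {d} deg≤d = ≤-trans
    (length-⊆ edges-unique λ {(u , v)} e →
      ∈-concatMap darts (∈-allFin u) (∈-map⁺ (u ,_) (∈-adjacents (edges-adjacent e))))
    (length-concatMap-≤ darts (allFin (order G)) (≤-reflexive (length-allFin (order G)))
      (λ u → ≤-trans (≤-reflexive (length-map (u ,_) (adjacents u))) (deg≤d u)))
    where
    darts : Vertex G → List (Vertex G × Vertex G)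
    darts u = map (u ,_) (adjacents u)

  leaf? : ∀ v → Dec (Leaf G v)
  leaf? v = degree v ≟ℕ 1

_[_↦_] : ∀ {A : Set} {m} → (Fin m → A) → Fin m → A → Fin m → A
φ [ v ↦ w ] = updateAt φ v (const w)

updateAt-∉ : ∀ {A : Set} {m} {φ : Fin m → A} {P v w u} → v ∉ P → u ∈ P → (φ [ v ↦ w ]) u ≡ φ u
updateAt-∉ {φ = φ} {v = v} {u = u} v∉P u∈P = updateAt-minimal u v φ λ { refl → v∉P u∈P }

singleton-≡ : ∀ {A : Set} {xs : List A} {x y} → length xs ≡ 1 → x ∈ xs → y ∈ xs → x ≡ y
singleton-≡ {xs = _ ∷ []} _ (here refl) (here refl) = refl

module _ {k n : ℕ} (c : EdgeColouring k n) (G : Graph) where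
  open EdgeColouring c
  open Graph G using (_~_; ~-sym; ~-irrefl; degree)

  private
    V : Set
    V = Vertex G

  -- A partial rainbow embedding: `φ` is total, but only its values on the placed vertices `P` are
  -- constrained.
  record RainbowOn (P : List V) (φ : V → Fin n) : Set where
    field
      injective : ∀ {u v} → u ∈ P → v ∈ P → φ u ≡ φ v → u ≡ v
      rainbow   : ∀ {u v x y} → u ∈ P → v ∈ P → x ∈ P → y ∈ P → u ~ v → x ~ y →
                  colour (φ u) (φ v) ≡ colour (φ x) (φ y) →
                  (u ≡ x × v ≡ y) ⊎ (u ≡ y × v ≡ x)

  RainbowOn⇒RainbowCopy : ∀ {P φ} → RainbowOn P φ → (∀ v → v ∈ P) → RainbowCopy c G
  RainbowOn⇒RainbowCopy {φ = φ} r all = record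
    { embed = φ
    ; injective = injective (all _) (all _)
    ; rainbow = rainbow (all _) (all _) (all _) (all _)
    }
    where open RainbowOn r

  -- An edge within `v ∷ P` either is old or joins `v` to some `u` in `P`. Clashes between two old
  -- edges are excluded by `r`, between a new and an old edge by `new≢old`, and between two new
  -- edges by `new≢new`.
  RainbowOn-extend : ∀ {P φ v w} → RainbowOn P φ → v ∉ P →
    (∀ u → w ≢ φ u) →
    (∀ {u y z} → v ~ u → y ~ z → colour (φ u) w ≢ colour (φ y) (φ z)) →
    (∀ {u u′} → u ∈ P → u′ ∈ P → v ~ u → v ~ u′ → colour (φ u) w ≡ colour (φ u′) w → u ≡ u′) →
    RainbowOn (v ∷ P) (φ [ v ↦ w ])
  RainbowOn-extend {P} {φ} {v} {w} r v∉P unused new≢old new≢new = record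
    { injective = injective′ ; rainbow = rainbow′ }
    where
    open RainbowOn r
    φ′ : V → Fin n
    φ′ = φ [ v ↦ w ]

    φ′v : φ′ v ≡ w
    φ′v = updateAt-updates v φ

    φ′∈ : ∀ {u} → u ∈ P → φ′ u ≡ φ u
    φ′∈ = updateAt-∉ v∉P

    injective′ : ∀ {x y} → x ∈ v ∷ P → y ∈ v ∷ P → φ′ x ≡ φ′ y → x ≡ y
    injective′ (here refl) (here refl) _ = refl
    injective′ (here refl) (there y∈) eq =
      contradiction (trans (sym φ′v) (trans eq (φ′∈ y∈))) (unused _)
    injective′ (there x∈) (here refl) eq =
      contradiction (trans (sym φ′v) (trans (sym eq) (φ′∈ x∈))) (unused _)
    injective′ (there x∈) (there y∈) eq =
      injective x∈ y∈ (trans (sym (φ′∈ x∈)) (trans eq (φ′∈ y∈)))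

    classify : ∀ {x y} → x ∈ v ∷ P → y ∈ v ∷ P → x ~ y →
      (x ∈ P × y ∈ P × colour (φ′ x) (φ′ y) ≡ colour (φ x) (φ y)) ⊎
      (∃ λ u → u ∈ P × v ~ u × ((x ≡ v × y ≡ u) ⊎ (x ≡ u × y ≡ v)) ×
               colour (φ′ x) (φ′ y) ≡ colour (φ u) w)
    classify (here refl) (here refl) v~v = contradiction v~v ~-irrefl
    classify (here refl) (there y∈) v~y =
      inj₂ (_ , y∈ , v~y , inj₁ (refl , refl) , trans (colour-sym _ _) (cong₂ colour (φ′∈ y∈) φ′v))
    classify (there x∈) (here refl) x~v =
      inj₂ (_ , x∈ , ~-sym x~v , inj₂ (refl , refl) , cong₂ colour (φ′∈ x∈) φ′v)
    classify (there x∈) (there y∈) _ =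
      inj₁ (x∈ , y∈ , cong₂ colour (φ′∈ x∈) (φ′∈ y∈))

    rainbow′ : ∀ {x y x′ y′} → x ∈ v ∷ P → y ∈ v ∷ P → x′ ∈ v ∷ P → y′ ∈ v ∷ P → x ~ y → x′ ~ y′ →
               colour (φ′ x) (φ′ y) ≡ colour (φ′ x′) (φ′ y′) →
               (x ≡ x′ × y ≡ y′) ⊎ (x ≡ y′ × y ≡ x′)
    rainbow′ x∈ y∈ x′∈ y′∈ x~y x′~y′ eq
      with classify x∈ y∈ x~y | classify x′∈ y′∈ x′~y′
    ... | inj₁ (p , q , e) | inj₁ (p′ , q′ , e′) =
      rainbow p q p′ q′ x~y x′~y′ (trans (sym e) (trans eq e′))
    ... | inj₁ (_ , _ , e) | inj₂ (_ , _ , v~u′ , _ , e′) =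
      contradiction (trans (sym e′) (trans (sym eq) e)) (new≢old v~u′ x~y)
    ... | inj₂ (_ , _ , v~u , _ , e) | inj₁ (_ , _ , e′) =
      contradiction (trans (sym e) (trans eq e′)) (new≢old v~u x′~y′)
    ... | inj₂ (u , u∈ , v~u , ends , e) | inj₂ (u′ , u′∈ , v~u′ , ends′ , e′)
      with new≢new u∈ u′∈ v~u v~u′ (trans (sym e) (trans eq e′)) | ends | ends′
    ...   | refl | inj₁ (refl , refl) | inj₁ (refl , refl) = inj₁ (refl , refl)
    ...   | refl | inj₁ (refl , refl) | inj₂ (refl , refl) = inj₂ (refl , refl)
    ...   | refl | inj₂ (refl , refl) | inj₁ (refl , refl) = inj₂ (refl , refl)
    ...   | refl | inj₂ (refl , refl) | inj₂ (refl , refl) = inj₁ (refl , refl)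

  -- The images of unplaced vertices are arbitrary; avoiding them too is
  -- harmless and makes the number of forbidden points independent of P.
  greedy-step : ∀ {P φ v δ η Δ} B → RainbowOn P φ → v ∉ P →
    degree v ≤ δ → edgeCount G ≤ η → (∀ p i → length (neighbours c p i) ≤ Δ) →
    order G + δ * (η * Δ) + length B < n →
    (∀ {w} → w ∉ B → (∀ u → w ≢ φ u) → ∀ {u u′} → u ∈ P → u′ ∈ P → v ~ u → v ~ u′ →
       colour (φ u) w ≡ colour (φ u′) w → u ≡ u′) →
    ∃ λ w → w ∉ B × RainbowOn (v ∷ P) (φ [ v ↦ w ])
  greedy-step {P} {φ} {v} {δ} {η} {Δ} B r v∉P deg edg nb short cherry =
    w , w∉B , RainbowOn-extend r v∉P unused new≢old (cherry w∉B unused)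
    where
    used : List (Fin n)
    used = map φ (allFin (order G))

    -- Only points of this list, at most `Δ` in number, repeat the colour of the edge `(y , z)` when
    -- joined to `φ u`.
    repeating : V → V × V → List (Fin n)
    repeating u (y , z) = neighbours c (φ u) (colour (φ y) (φ z))

    repeatingAny : V → List (Fin n)
    repeatingAny u = concatMap (repeating u) (edges G)

    repeated : List (Fin n)
    repeated = concatMap repeatingAny (adjacents G v)

    bound : length (used ++ repeated ++ B) ≤ order G + δ * (η * Δ) + length B
    bound = ≤-trans
      (length-++-≤ used
        (≤-reflexive (trans (length-map φ (allFin (order G))) (length-allFin (order G))))
        (length-++-≤ repeated
          (length-concatMap-≤ repeatingAny (adjacents G v) deg
            (λ u → length-concatMap-≤ (repeating u) (edges G) edg (λ _ → nb _ _)))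
          ≤-refl))
      (≤-reflexive (sym (+-assoc (order G) _ _)))

    found : ∃ λ w → w ∉ used ++ repeated ++ B
    found = fresh (used ++ repeated ++ B) (≤-<-trans bound short)

    w : Fin n
    w = proj₁ found

    w∉ : w ∉ used ++ repeated ++ B
    w∉ = proj₂ found

    unused : ∀ u → w ≢ φ u
    unused u eq = w∉ (subst (_∈ used ++ repeated ++ B) (sym eq) (∈-++⁺ˡ (∈-map⁺ φ (∈-allFin u))))

    w∉B : w ∉ B
    w∉B = w∉ ∘ ∈-++⁺ʳ used ∘ ∈-++⁺ʳ repeated

    new≢old : ∀ {u y z} → v ~ u → y ~ z → colour (φ u) w ≢ colour (φ y) (φ z)
    new≢old {u} {y} {z} v~u y~z eq = w∉ (∈-++⁺ʳ used (∈-++⁺ˡ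
      (∈-concatMap repeatingAny (∈-adjacents G v~u)
        ([ (λ e → ∈-concatMap (repeating u) e (repeats eq))
         , (λ e → ∈-concatMap (repeating u) e (repeats (trans eq (colour-sym _ _)))) ]′ (∈-edges G y~z)))))
      where
      repeats : ∀ {i} → colour (φ u) w ≡ i → w ∈ neighbours c (φ u) i
      repeats e = ∈-filter⁺ _ (∈-allFin w) (unused u , e)

  -- Vertices already placed are skipped, so the process can start from the empty embedding or from
  -- an embedded core.
  grow : ∀ {Inv : List V → (V → Fin n) → Set} →
    (∀ {P φ v} → Inv P φ → v ∉ P → ∃ λ φ′ → Inv (v ∷ P) φ′) →
    ∀ xs {P φ} → Inv P φ → ∃₂ λ P′ φ′ → Inv P′ φ′ × P ⊆ P′ × xs ⊆ P′
  grow step [] inv = _ , _ , inv , id , λ ()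
  grow step (x ∷ xs) {P} inv with DecMembership._∈?_ _≟_ x P
  ... | yes x∈P with grow step xs inv
  ...   | P′ , φ′ , inv′ , P⊆ , xs⊆ = P′ , φ′ , inv′ , P⊆ , λ { (here refl) → P⊆ x∈P ; (there p) → xs⊆ p }
  grow step (x ∷ xs) {P} inv | no x∉P with step inv x∉P
  ... | _ , inv₁ with grow step xs inv₁
  ...   | P′ , φ′ , inv′ , P⊆ , xs⊆ =
          P′ , φ′ , inv′ , P⊆ ∘ there , λ { (here refl) → P⊆ (here refl) ; (there p) → xs⊆ p }

-- Putting deleted leaves back

module _ {k n : ℕ} (c : EdgeColouring k n) {G H : Graph} (D : DeletesAllLeaves G H) where
  open DeletesAllLeaves D renaming (embed to ι; injective to ι-injective)
  open Graph G using (_~_)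

  -- The copy of `H` places all non-leaves, so every vertex still to be placed is a leaf. Its one
  -- edge must avoid at most `η` colours, which costs at most `η * Δ` points besides the `order G`
  -- used ones.
  RainbowCopy-addLeaves : ∀ {η Δ} → edgeCount G ≤ η →
    (∀ p i → length (neighbours c p i) ≤ Δ) →
    order G + η * Δ < n → RainbowCopy c H → RainbowCopy c G
  RainbowCopy-addLeaves {η} {Δ} edg nb short copy =
    let _ , _ , (r , _) , _ , all = grow c G {Inv} step (allFin (order G)) start
    in RainbowOn⇒RainbowCopy c G r (λ v → all (∈-allFin v))
    where
    open RainbowCopy copy

    place : ∀ v → Dec (Leaf G v) → Fin n
    -- A default point, which exists since `short` makes `n` positive; leaves are not yet in `core`.
    place v (yes _)  = fromℕ< {0} (≤-trans (s≤s z≤n) short)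
    place v (no ¬lf) = embed (proj₁ (Equivalence.from (image v) ¬lf))

    φ₀ : Vertex G → Fin n
    φ₀ v = place v (leaf? G v)

    core : List (Vertex G)
    core = filter (¬? ∘ leaf? G) (allFin (order G))

    Inv : List (Vertex G) → (Vertex G → Fin n) → Set
    Inv P φ = RainbowOn c G P φ × (∀ {v} → ¬ Leaf G v → v ∈ P)

    preimage : ∀ {v} → v ∈ core → ∃ λ u → ι u ≡ v × φ₀ v ≡ embed u
    preimage {v} v∈ with leaf? G v
    ... | yes lf = contradiction lf (proj₂ (∈-filter⁻ (¬? ∘ leaf? G) {xs = allFin _} v∈))
    ... | no ¬lf = let u , eq = Equivalence.from (image v) ¬lf in u , eq , refl

    start : Inv core φ₀
    start = record { injective = inj ; rainbow = rb } , ∈-filter⁺ _ (∈-allFin _)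
      where
      inj : ∀ {u v} → u ∈ core → v ∈ core → φ₀ u ≡ φ₀ v → u ≡ v
      inj u∈ v∈ eq with preimage u∈ | preimage v∈
      ... | _ , refl , e | _ , refl , e′ = cong ι (injective (trans (sym e) (trans eq e′)))

      rb : ∀ {u v x y} → u ∈ core → v ∈ core → x ∈ core → y ∈ core → u ~ v → x ~ y →
           EdgeColouring.colour c (φ₀ u) (φ₀ v) ≡ EdgeColouring.colour c (φ₀ x) (φ₀ y) →
           (u ≡ x × v ≡ y) ⊎ (u ≡ y × v ≡ x)
      rb u∈ v∈ x∈ y∈ u~v x~y eq
        with preimage u∈ | preimage v∈ | preimage x∈ | preimage y∈
      ... | _ , refl , e₁ | _ , refl , e₂ | _ , refl , e₃ | _ , refl , e₄
        with rainbow (Equivalence.from (adjacency _ _) u~v) (Equivalence.from (adjacency _ _) x~y)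
               (trans (sym (cong₂ (EdgeColouring.colour c) e₁ e₂))
                 (trans eq (cong₂ (EdgeColouring.colour c) e₃ e₄)))
      ...   | inj₁ (refl , refl) = inj₁ (refl , refl)
      ...   | inj₂ (refl , refl) = inj₂ (refl , refl)

    step : ∀ {P φ v} → Inv P φ → v ∉ P → ∃ λ φ′ → Inv (v ∷ P) φ′
    step {P} {φ} {v} (r , ¬lf⇒∈) v∉P =
      -- A leaf has a single neighbour, so no two new edges can clash and the list of additional
      -- forbidden points is empty.
      let w , _ , r′ = greedy-step c G {δ = 1} [] r v∉P (≤-reflexive leaf) edg nb short′
                         (λ _ _ _ _ v~u v~u′ _ → singleton-≡ leaf (∈-adjacents G v~u) (∈-adjacents G v~u′))
      in _ , r′ , there ∘ ¬lf⇒∈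
      where
      leaf : Leaf G v
      leaf = decidable-stable (leaf? G v) (v∉P ∘ ¬lf⇒∈)

      short′ : order G + 1 * (η * Δ) + 0 < n
      short′ = subst (_< n) (sym (trans (+-identityʳ _) (cong (order G +_) (*-identityˡ _)))) short

-- Embedding a graph of bounded degree

module _ {k n : ℕ} (c : EdgeColouring k n) (M : ℕ) where
  open EdgeColouring c

  -- A monochromatic cherry with centre `w` and ends `p` and `p′`.
  Twin : Fin n → Fin n → Fin n → Set
  Twin p p′ w = w ≢ p × w ≢ p′ × colour p w ≡ colour p′ w

  twin? : ∀ p p′ w → Dec (Twin p p′ w)
  twin? p p′ w = ¬? (w ≟ p) ×-dec (¬? (w ≟ p′) ×-dec (colour p w ≟ colour p′ w))

  twins : Fin n → Fin n → List (Fin n)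
  twins p p′ = filter (twin? p p′) (allFin n)

  Bad : Fin n → Fin n → Set
  Bad p p′ = M ≤ length (twins p p′)

  bad? : ∀ p p′ → Dec (Bad p p′)
  bad? p p′ = M ≤? length (twins p p′)

  Bad-sym : ∀ {p p′} → Bad p p′ → Bad p′ p
  Bad-sym {p} {p′} = subst (M ≤_) (cong length (filter-≐ (twin? p p′) (twin? p′ p) (flip-twin , flip-twin) (allFin n)))
    where
    flip-twin : ∀ {p p′ w} → Twin p p′ w → Twin p′ p w
    flip-twin (a , b , e) = b , a , sym e

  badPartners : Fin n → List (Fin n)
  badPartners p = filter (bad? p) (allFin n)

  -- Emptied at bad pairs, so that the length bound `M` holds for all pairs, including those with
  -- unplaced and hence arbitrary images.
  goodTwins : Fin n → Fin n → List (Fin n)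
  goodTwins p p′ with bad? p p′
  ... | yes _ = []
  ... | no _  = twins p p′

  length-goodTwins : ∀ p p′ → length (goodTwins p p′) ≤ M
  length-goodTwins p p′ with bad? p p′
  ... | yes _ = z≤n
  ... | no ¬b = <⇒≤ (≰⇒> ¬b)

  ∈-goodTwins : ∀ {p p′ w} → ¬ Bad p p′ → Twin p p′ w → w ∈ goodTwins p p′
  ∈-goodTwins {p} {p′} {w} ¬b t with bad? p p′
  ... | yes b = contradiction b ¬b
  ... | no _  = ∈-filter⁺ _ (∈-allFin w) t

  -- Counts cherries with end `p`. Each bad partner contributes at least `M` centres; a centre `w`
  -- fixes the colour `colour p w`, so the other end is one of at most `Δ` neighbours of `w` in that
  -- colour.
  badPartners-count : ∀ {Δ} → (∀ p i → length (neighbours c p i) ≤ Δ) → ∀ p →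
                      length (badPartners p) * M ≤ n * Δ
  badPartners-count {Δ} nb p = subst (λ l → length (badPartners p) * M ≤ l * Δ) (length-allFin n)
    (double-count (twin? p) (badPartners p) (allFin n)
      (λ p′∈ → proj₂ (∈-filter⁻ (bad? p) {xs = allFin n} p′∈))
      (λ w → ≤-trans
        (length-⊆ (Unique.filter⁺ _ (Unique.filter⁺ _ (Unique.allFin⁺ n))) (sub w))
        (nb w (colour p w))))
    where
    sub : ∀ w {p′} → p′ ∈ filter (λ p′ → twin? p p′ w) (badPartners p) → p′ ∈ neighbours c w (colour p w)
    sub w {p′} p′∈ with ∈-filter⁻ (λ p′ → twin? p p′ w) {xs = badPartners p} p′∈
    ... | _ , _ , w≢p′ , eq = ∈-filter⁺ _ (∈-allFin p′) (w≢p′ ∘ sym , trans (colour-sym _ _) (sym eq))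

  -- The summands count the points forbidden at one step: used points, repeated colours, centres of
  -- cherries over two neighbours of the new vertex, and bad partners of vertices sharing a
  -- neighbour with it.
  RainbowCopy-boundedDegree : (G : Graph) → ∀ {d Δ β} → (∀ v → Graph.degree G v ≤ d) →
    (∀ p i → length (neighbours c p i) ≤ Δ) → (∀ p → length (badPartners p) ≤ β) →
    order G + d * (order G * d * Δ) + (d * (d * M) + d * (d * β)) < n → RainbowCopy c G
  RainbowCopy-boundedDegree G {d} {Δ} {β} deg nb partners short =
    let _ , _ , (r , _) , _ , all =
          grow c G {Inv} step (allFin (order G)) {[]} {const (fromℕ< {0} (≤-trans (s≤s z≤n) short))} start
    in RainbowOn⇒RainbowCopy c G r (λ v → all (∈-allFin v))
    where
    open Graph G using (_~_)

    -- The common neighbour y of u and u′ need not be placed yet: the pair must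
    -- be good before y's turn comes.
    Inv : List (Vertex G) → (Vertex G → Fin n) → Set
    Inv P φ = RainbowOn c G P φ ×
      (∀ {u u′ y} → u ∈ P → u′ ∈ P → y ~ u → y ~ u′ → u ≢ u′ → ¬ Bad (φ u) (φ u′))

    start : ∀ {φ} → Inv [] φ
    start = record { injective = λ () ; rainbow = λ () } , λ ()

    step : ∀ {P φ v} → Inv P φ → v ∉ P → ∃ λ φ′ → Inv (v ∷ P) φ′
    step {P} {φ} {v} (r , good) v∉P = _ , proj₂ (proj₂ found) , good′
      where
      cherriesAt : Vertex G → List (Fin n)
      cherriesAt u = concatMap (λ u′ → goodTwins (φ u) (φ u′)) (adjacents G v)

      -- Once `v` is placed, its image must form good pairs with those of the other neighbours of
      -- `y`, for every `y` adjacent to `v`.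
      badAt : Vertex G → List (Fin n)
      badAt y = concatMap (badPartners ∘ φ) (adjacents G y)

      cherries secondBad : List (Fin n)
      cherries  = concatMap cherriesAt (adjacents G v)
      secondBad = concatMap badAt (adjacents G v)

      bound : length (cherries ++ secondBad) ≤ d * (d * M) + d * (d * β)
      bound = length-++-≤ cherries
        (length-concatMap-≤ cherriesAt (adjacents G v) (deg v) λ u →
          length-concatMap-≤ (λ u′ → goodTwins (φ u) (φ u′)) (adjacents G v) (deg v) λ u′ →
            length-goodTwins _ _)
        (length-concatMap-≤ badAt (adjacents G v) (deg v) λ y →
          length-concatMap-≤ (badPartners ∘ φ) (adjacents G y) (deg y) λ u → partners _)

      cherry : ∀ {w} → w ∉ cherries ++ secondBad → (∀ u → w ≢ φ u) →
        ∀ {u u′} → u ∈ P → u′ ∈ P → v ~ u → v ~ u′ → colour (φ u) w ≡ colour (φ u′) w → u ≡ u′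
      cherry w∉ unused {u} {u′} u∈ u′∈ v~u v~u′ eq = decidable-stable (u ≟ u′) λ u≢u′ →
        w∉ (∈-++⁺ˡ (∈-concatMap cherriesAt (∈-adjacents G v~u)
          (∈-concatMap (λ u′ → goodTwins (φ u) (φ u′)) (∈-adjacents G v~u′)
            (∈-goodTwins (good u∈ u′∈ v~u v~u′ u≢u′) (unused u , unused u′ , eq)))))

      found : ∃ λ w → w ∉ cherries ++ secondBad × RainbowOn c G (v ∷ P) (φ [ v ↦ w ])
      found = greedy-step c G (cherries ++ secondBad) r v∉P (deg v) (edgeCount-≤ G deg) nb
                (≤-<-trans (+-monoʳ-≤ (order G + d * (order G * d * Δ)) bound) short) cherry

      w : Fin n
      w = proj₁ found

      w∉ : w ∉ cherries ++ secondBad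
      w∉ = proj₁ (proj₂ found)

      φ′v : (φ [ v ↦ w ]) v ≡ w
      φ′v = updateAt-updates v φ

      φ′∈ : ∀ {u} → u ∈ P → (φ [ v ↦ w ]) u ≡ φ u
      φ′∈ = updateAt-∉ v∉P

      ¬bad : ∀ {u y} → y ~ v → y ~ u → ¬ Bad (φ u) w
      ¬bad y~v y~u b = w∉ (∈-++⁺ʳ cherries (∈-concatMap badAt (∈-adjacents G (Graph.~-sym G y~v))
        (∈-concatMap (badPartners ∘ φ) (∈-adjacents G y~u) (∈-filter⁺ _ (∈-allFin w) b))))

      good′ : ∀ {u u′ y} → u ∈ v ∷ P → u′ ∈ v ∷ P → y ~ u → y ~ u′ → u ≢ u′ →
              ¬ Bad ((φ [ v ↦ w ]) u) ((φ [ v ↦ w ]) u′)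
      good′ (here refl) (here refl) _ _ u≢u′ _ = u≢u′ refl
      good′ (here refl) (there u′∈) y~v y~u′ _ b =
        ¬bad y~v y~u′ (Bad-sym (subst₂ Bad φ′v (φ′∈ u′∈) b))
      good′ (there u∈) (here refl) y~u y~v _ b =
        ¬bad y~v y~u (subst₂ Bad (φ′∈ u∈) φ′v b)
      good′ (there u∈) (there u′∈) y~u y~u′ u≢u′ b =
        good u∈ u′∈ y~u y~u′ u≢u′ (subst₂ Bad (φ′∈ u∈) (φ′∈ u′∈) b)

-- Vertex and edge counts under deletion of leaves

-- The representative under which `edges` lists an unordered pair.
arrange : ∀ {n} → Fin n × Fin n → Fin n × Fin n
arrange (u , v) with <-cmp u v
... | tri> _ _ _ = v , u
... | _          = u , v

arrange-sorted : ∀ {n} {u v : Fin n} → u <ᶠ v → arrange (u , v) ≡ (u , v)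
arrange-sorted {u = u} {v} u<v with <-cmp u v
... | tri< _ _ _   = refl
... | tri≈ _ _ _   = refl
... | tri> ¬u<v _ _ = contradiction u<v ¬u<v

arrange-swap : ∀ {n} {u v : Fin n} → u <ᶠ v → arrange (v , u) ≡ (u , v)
arrange-swap {u = u} {v} u<v with <-cmp v u
... | tri< _ _ ¬u<v = contradiction u<v ¬u<v
... | tri≈ _ _ ¬u<v = contradiction u<v ¬u<v
... | tri> _ _ _    = refl

arrange-≡ : ∀ {n} (p : Fin n × Fin n) → arrange p ≡ p ⊎ arrange p ≡ swap p
arrange-≡ (u , v) with <-cmp u v
... | tri< _ _ _ = inj₁ refl
... | tri≈ _ _ _ = inj₁ refl
... | tri> _ _ _ = inj₂ refl

arrange-injective : ∀ {n} (p q : Fin n × Fin n) → arrange p ≡ arrange q → p ≡ q ⊎ p ≡ swap q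
arrange-injective p q eq with arrange-≡ p | arrange-≡ q
... | inj₁ a | inj₁ b = inj₁ (trans (sym a) (trans eq b))
... | inj₁ a | inj₂ b = inj₂ (trans (sym a) (trans eq b))
... | inj₂ a | inj₁ b = inj₂ (cong swap (trans (sym a) (trans eq b)))
... | inj₂ a | inj₂ b = inj₁ (cong swap (trans (sym a) (trans eq b)))

module _ (G : Graph) where

  edges-sorted : ∀ {u v} → (u , v) ∈ edges G → u <ᶠ v
  edges-sorted = proj₁ ∘ proj₂ ∘ ∈-filter⁻ _ {xs = cartesianProduct (allFin (order G)) _}

  arrange∈edges : ∀ {u v} → Graph._~_ G u v → arrange (u , v) ∈ edges G
  arrange∈edges u~v with ∈-edges G u~v
  ... | inj₁ e = subst (_∈ edges G) (sym (arrange-sorted (edges-sorted e))) e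
  ... | inj₂ e = subst (_∈ edges G) (sym (arrange-swap (edges-sorted e))) e

  -- Meaningful at leaves only; elsewhere the value is a default.
  pendant : Vertex G → Vertex G × Vertex G
  pendant v with adjacents G v
  ... | []    = v , v
  ... | u ∷ _ = arrange (v , u)

  pendant-≡ : ∀ {v u} → Leaf G v → Graph._~_ G v u → pendant v ≡ arrange (v , u)
  pendant-≡ {v} {u} leaf v~u with adjacents G v | leaf | ∈-adjacents G v~u
  ... | _ ∷ [] | _ | here refl = refl

  degree≤maxDegree : ∀ v → Graph.degree G v ≤ maxDegree G
  degree≤maxDegree v =
    All.lookup (xs≤max 0 (map (Graph.degree G) (allFin (order G)))) (∈-map⁺ (Graph.degree G) (∈-allFin v))

  maxDegree≤order : maxDegree G ≤ order G
  maxDegree≤order = max≤v⁺ z≤n (All.tabulate bound)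
    where
    bound : ∀ {x} → x ∈ map (Graph.degree G) (allFin (order G)) → x ≤ order G
    bound x∈ with ∈-map⁻ (Graph.degree G) x∈
    ... | v , _ , refl = ≤-trans (length-filter _ (allFin (order G))) (≤-reflexive (length-allFin (order G)))

module _ {G H : Graph} (D : DeletesAllLeaves G H) where
  open DeletesAllLeaves D renaming (embed to ι; injective to ι-injective)
  open Graph G using (_~_)

  private
    image-edge : Vertex H × Vertex H → Vertex G × Vertex G
    image-edge (x , y) = arrange (ι x , ι y)

    leaves : List (Vertex G)
    leaves = filter (leaf? G) (allFin (order G))

  -- The image of `ι` consists of non-leaves, so together with `leaves` it repeats no vertex.
  order-DeletesAllLeaves : order H + length leaves ≤ order G
  order-DeletesAllLeaves = begin
    order H + length leaves
      ≡⟨ cong (_+ length leaves) (trans (length-map ι (allFin (order H))) (length-allFin (order H))) ⟨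
    length (map ι (allFin (order H))) + length leaves   ≡⟨ length-++ (map ι (allFin (order H))) ⟨
    length (map ι (allFin (order H)) ++ leaves)         ≤⟨ length-⊆ unique (λ {v} _ → ∈-allFin v) ⟩
    length (allFin (order G))                           ≡⟨ length-allFin (order G) ⟩
    order G                                             ∎
    where
    open ≤-Reasoning
    disjoint : ∀ {v} → ¬ (v ∈ map ι (allFin (order H)) × v ∈ leaves)
    disjoint (v∈ , v∈leaves) with ∈-map⁻ ι v∈
    ... | x , _ , refl = Equivalence.to (image (ι x)) (x , refl)
                           (proj₂ (∈-filter⁻ (leaf? G) {xs = allFin (order G)} v∈leaves))

    unique : Unique (map ι (allFin (order H)) ++ leaves)
    unique = Unique.++⁺ (Unique.map⁺ ι-injective (Unique.allFin⁺ _)) (Unique.filter⁺ _ (Unique.allFin⁺ _)) disjoint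

  -- An edge either has both ends in the image of `H` or is pendant at a leaf. A `K 2` component is
  -- pendant at both its ends, whence only an inequality.
  edgeCount-DeletesAllLeaves : edgeCount G ≤ edgeCount H + length leaves
  edgeCount-DeletesAllLeaves = begin
    length (edges G)                                            ≤⟨ length-⊆ (edges-unique G) cover ⟩
    length (map image-edge (edges H) ++ map (pendant G) leaves) ≡⟨ length-++ (map image-edge (edges H)) ⟩
    length (map image-edge (edges H)) + length (map (pendant G) leaves)
      ≡⟨ cong₂ _+_ (length-map image-edge (edges H)) (length-map (pendant G) leaves) ⟩
    edgeCount H + length leaves                                 ∎
    where
    open ≤-Reasoning
    cover : ∀ {e} → e ∈ edges G → e ∈ map image-edge (edges H) ++ map (pendant G) leaves
    cover {u , v} e∈ with edges-sorted G e∈ | edges-adjacent G e∈ | leaf? G u | leaf? G v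
    ... | u<v | u~v | yes lf | _ =
      ∈-++⁺ʳ (map image-edge (edges H)) (subst (_∈ _) (trans (pendant-≡ G lf u~v) (arrange-sorted u<v))
        (∈-map⁺ (pendant G) (∈-filter⁺ (leaf? G) (∈-allFin u) lf)))
    ... | u<v | u~v | no _ | yes lf =
      ∈-++⁺ʳ (map image-edge (edges H)) (subst (_∈ _) (trans (pendant-≡ G lf (Graph.~-sym G u~v)) (arrange-swap u<v))
        (∈-map⁺ (pendant G) (∈-filter⁺ (leaf? G) (∈-allFin v) lf)))
    ... | u<v | u~v | no ¬lfu | no ¬lfv
      with Equivalence.from (image u) ¬lfu | Equivalence.from (image v) ¬lfv
    ...   | x , refl | y , refl with ∈-edges H (Equivalence.from (adjacency x y) u~v)
    ...     | inj₁ e = ∈-++⁺ˡ (subst (_∈ _) (arrange-sorted u<v) (∈-map⁺ image-edge e))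
    ...     | inj₂ e = ∈-++⁺ˡ (subst (_∈ _) (arrange-swap u<v) (∈-map⁺ image-edge e))

  edgeCount-mono : edgeCount H ≤ edgeCount G
  edgeCount-mono = length-injectiveOn image-edge (edges-unique H)
    (λ {(x , y)} e → arrange∈edges G (Equivalence.to (adjacency x y) (edges-adjacent H e)))
    injective
    where
    injective : ∀ {p q} → p ∈ edges H → q ∈ edges H → image-edge p ≡ image-edge q → p ≡ q
    injective {x , y} {x′ , y′} p q eq with arrange-injective (ι x , ι y) (ι x′ , ι y′) eq
    ... | inj₁ e = cong₂ _,_ (ι-injective (cong proj₁ e)) (ι-injective (cong proj₂ e))
    ... | inj₂ e with ι-injective (cong proj₁ e) | ι-injective (cong proj₂ e)
    -- Two listed edges that are reversals of each other cannot both be sorted.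
    ...   | refl | refl = contradiction (edges-sorted H q) (<-asym (edges-sorted H p))

  -- Edges minus vertices does not decrease from `G` to `H`, written without subtraction: every lost
  -- edge is charged to a lost leaf.
  excess-mono : edgeCount G + order H ≤ order G + edgeCount H
  excess-mono = begin
    edgeCount G + order H                      ≤⟨ +-monoˡ-≤ (order H) edgeCount-DeletesAllLeaves ⟩
    edgeCount H + length leaves + order H      ≡⟨ rearrange (edgeCount H) (length leaves) (order H) ⟩
    order H + length leaves + edgeCount H      ≤⟨ +-monoˡ-≤ (edgeCount H) order-DeletesAllLeaves ⟩
    order G + edgeCount H                      ∎
    where
    open ≤-Reasoning
    rearrange : ∀ a b c → a + b + c ≡ c + b + a
    rearrange = solve-∀

-- Iterated deletion of leaves

Peels : Graph → Graph → Set₁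
Peels = Star DeletesAllLeaves

Peels-edgeCount : ∀ {G H} → Peels G H → edgeCount H ≤ edgeCount G
Peels-edgeCount ε = ≤-refl
Peels-edgeCount (D ◅ Ds) = ≤-trans (Peels-edgeCount Ds) (edgeCount-mono D)

Peels-excess : ∀ {G H} → Peels G H → edgeCount G + order H ≤ order G + edgeCount H
Peels-excess {G} ε = ≤-reflexive (+-comm (edgeCount G) (order G))
-- The inequalities for both stages are added, and the terms of the intermediate graph `G′` cancel.
Peels-excess {G} {H} (_◅_ {j = G′} D Ds) = +-cancelʳ-≤ (edgeCount G′ + order G′) _ _ (begin
  edgeCount G + order H + (edgeCount G′ + order G′)    ≡⟨ rearrange₁ (edgeCount G) (order H) (edgeCount G′) (order G′) ⟩
  (edgeCount G + order G′) + (edgeCount G′ + order H)  ≤⟨ +-mono-≤ (excess-mono D) (Peels-excess Ds) ⟩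
  (order G + edgeCount G′) + (order G′ + edgeCount H)  ≡⟨ rearrange₂ (order G) (edgeCount G′) (order G′) (edgeCount H) ⟩
  order G + edgeCount H + (edgeCount G′ + order G′)    ∎)
  where
  open ≤-Reasoning
  rearrange₁ : ∀ a b c d → a + b + (c + d) ≡ (a + d) + (c + b)
  rearrange₁ = solve-∀
  rearrange₂ : ∀ a b c d → (a + b) + (c + d) ≡ a + d + (b + c)
  rearrange₂ = solve-∀

-- Order and edge count only shrink along the deletions, so the room required for `G` suffices at
-- every stage.
Peels-RainbowCopy : ∀ {G H k n η Δ} (c : EdgeColouring k n) → Peels G H → edgeCount G ≤ η →
  (∀ p i → length (neighbours c p i) ≤ Δ) → order G + η * Δ < n → RainbowCopy c H → RainbowCopy c G
Peels-RainbowCopy c ε _ _ _ r = r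
Peels-RainbowCopy {η = η} {Δ} c (D ◅ Ds) edg nb short r =
  RainbowCopy-addLeaves c D edg nb short
    (Peels-RainbowCopy c Ds (≤-trans (edgeCount-mono D) edg) nb
      (≤-<-trans (+-monoˡ-≤ (η * Δ) (≤-trans (m≤m+n _ _) (order-DeletesAllLeaves D))) short) r)

-- The sequence starts at index 1, so `suc a` is its last index and `a` its number of deletions.
Peels-sequence : ∀ (F : ℕ → Graph) a → (∀ i → 2 ≤ i → i ≤ suc a → DeletesAllLeaves (F (i ∸ 1)) (F i)) →
                 Peels (F 1) (F (suc a))
Peels-sequence F zero _ = ε
Peels-sequence F (suc a) D =
  Peels-sequence F a (λ i 2≤i i≤a → D i 2≤i (m≤n⇒m≤1+n i≤a)) ◅◅ (D (suc (suc a)) (s≤s (s≤s z≤n)) ≤-refl ◅ ε)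

-- Arithmetic of the bound

geometric : ℕ → ℕ → ℕ
geometric q zero    = 0
geometric q (suc m) = 1 + q * geometric q m

-- Free of subtraction, so that the induction step is a ring identity; it makes the quotient in
-- `geometric-/` exact.
geometric-pow : ∀ q m → geometric (suc q) m * q + 1 ≡ suc q ^ m
geometric-pow q zero = refl
geometric-pow q (suc m) = trans (rearrange q (geometric (suc q) m)) (cong (suc q *_) (geometric-pow q m))
  where
  rearrange : ∀ q g → (1 + (1 + q) * g) * q + 1 ≡ (1 + q) * (g * q + 1)
  rearrange = solve-∀

geometric-/ : ∀ q m .{{_ : NonZero (q ∸ 1)}} → (q ^ m ∸ 1) / (q ∸ 1) ≡ geometric q m
geometric-/ (suc q) m = trans
  (/-congˡ (trans (cong (_∸ 1) (sym (geometric-pow q m))) (m+n∸n≡m (geometric (suc q) m * q) 1)))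
  (m*n/n≡m (geometric (suc q) m) q)

bound : ℕ → ℕ → ℕ → ℕ
bound q x m = q ^ m + 4 * x * geometric q m

bound-suc : ∀ q x m → bound q x (suc m) ≡ q * bound q x m + 4 * x
bound-suc q x m = rearrange q x (q ^ m) (geometric q m)
  where
  rearrange : ∀ q x p g → q * p + 4 * x * (1 + q * g) ≡ q * (p + 4 * x * g) + 4 * x
  rearrange = solve-∀

bound-positive : ∀ q x m → 1 ≤ q → 1 ≤ bound q x m
bound-positive q x m 1≤q = ≤-trans (m^n>0 q {{>-nonZero 1≤q}} m) (m≤m+n _ _)

module _ {d x n Δ : ℕ} (2≤d : 2 ≤ d) (1≤x : 1 ≤ x) (n≡ : n ≡ base d x * suc Δ + 4 * x) where

  -- The value of `M` that makes `n` equal to `2 * (d * d) * threshold + 4 * x`: half of the main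
  -- term pays for the cherries, the other half is left for the remaining forbidden points.
  threshold : ℕ
  threshold = (x + 16 * (d * d)) * suc Δ

  private
    4≤d² : 4 ≤ d * d
    4≤d² = *-mono-≤ 2≤d 2≤d

    x≤threshold : x ≤ threshold
    x≤threshold = ≤-trans (m≤m+n x _) (m≤m*n _ (suc Δ))

  -- From `4 ≤ d * d` and `x ≤ threshold`, the term `4 * x` of `n` is at most `d * d * threshold`;
  -- then `threshold` cancels.
  partners-bound : ∀ {l} → l * threshold ≤ n * Δ → l ≤ 3 * (d * d) * Δ
  partners-bound {l} l*M≤ = *-cancelʳ-≤ l _ threshold {{>-nonZero (≤-trans 1≤x x≤threshold)}} (begin
    l * threshold                                     ≤⟨ l*M≤ ⟩
    n * Δ                                             ≡⟨ cong (_* Δ) (trans n≡ (expand d x Δ)) ⟩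
    (2 * (d * d) * threshold + 4 * x) * Δ             ≤⟨ *-monoˡ-≤ Δ (+-monoʳ-≤ (2 * (d * d) * threshold) (*-mono-≤ 4≤d² x≤threshold)) ⟩
    (2 * (d * d) * threshold + d * d * threshold) * Δ ≡⟨ collect (d * d) threshold Δ ⟩
    3 * (d * d) * Δ * threshold                       ∎)
    where
    open ≤-Reasoning
    expand : ∀ d x Δ → (2 * (d * (d * 1)) * x + 32 * (d * (d * (d * (d * 1))))) * (1 + Δ) + 4 * x ≡
                       2 * (d * d) * ((x + 16 * (d * d)) * (1 + Δ)) + 4 * x
    expand = solve-∀
    collect : ∀ a M Δ → (2 * a * M + a * M) * Δ ≡ 3 * a * Δ * M
    collect = solve-∀

  embedding-bound : ∀ {h} → h ≤ x →
    h + d * (h * d * Δ) + (d * (d * threshold) + d * (d * (3 * (d * d) * Δ))) < n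
  embedding-bound {h} h≤x = begin-strict
    h + d * (h * d * Δ) + rest                       ≤⟨ +-monoˡ-≤ rest (+-mono-≤ h≤x (*-monoʳ-≤ d (*-monoˡ-≤ Δ (*-monoˡ-≤ d h≤x)))) ⟩
    x + d * (x * d * Δ) + rest                       <⟨ m<m+n _ (≤-trans 1≤x (m≤m+n x _)) ⟩
    -- The bracket is the exact slack; its first summand `x` is positive and makes the inequality
    -- strict.
    x + d * (x * d * Δ) + rest + (x + (2 * x + d * d * x + 16 * (d * d * (d * d)) + 13 * (d * d * (d * d)) * Δ))
                                                     ≡⟨ collect d x Δ ⟩
    base d x * suc Δ + 4 * x                         ≡⟨ n≡ ⟨
    n                                                ∎
    where
    open ≤-Reasoning
    rest : ℕ
    rest = d * (d * threshold) + d * (d * (3 * (d * d) * Δ))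
    collect : ∀ d x Δ →
      x + d * (x * d * Δ) + (d * (d * ((x + 16 * (d * d)) * (1 + Δ))) + d * (d * (3 * (d * d) * Δ)))
        + (x + (2 * x + d * d * x + 16 * (d * d * (d * d)) + 13 * (d * d * (d * d)) * Δ))
      ≡ (2 * (d * (d * 1)) * x + 32 * (d * (d * (d * (d * 1))))) * (1 + Δ) + 4 * x
    collect = solve-∀

  -- With `b` replaced by `base d x`, the left side is at most `base d x * suc Δ + x`, which misses
  -- `n` by `3 * x`.
  leaves-bound : ∀ {s b} → s ≤ b + x → b ≤ base d x → s + b * Δ < n
  leaves-bound {s} {b} s≤ b≤ = begin-strict
    s + b * Δ                      ≤⟨ +-mono-≤ (≤-trans s≤ (+-monoˡ-≤ x b≤)) (*-monoˡ-≤ Δ b≤) ⟩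
    base d x + x + base d x * Δ    ≡⟨ rearrange (base d x) x Δ ⟩
    base d x * suc Δ + x           <⟨ +-monoʳ-< (base d x * suc Δ) (m<m+n x (*-mono-≤ (s≤s (z≤n {2})) 1≤x)) ⟩
    base d x * suc Δ + 4 * x       ≡⟨ n≡ ⟨
    n                              ∎
    where
    open ≤-Reasoning
    rearrange : ∀ q x Δ → q + x + q * Δ ≡ q * (1 + Δ) + x
    rearrange = solve-∀

-- The case of small monochromatic degrees and the final bound

RainbowCopy-sparse : ∀ {G H d x k n n′} (c : EdgeColouring k n) → Peels G H →
  (∀ v → Graph.degree H v ≤ d) → 2 ≤ d → 1 ≤ x → order H ≤ x →
  edgeCount G ≤ base d x → order G ≤ edgeCount G + x →
  1 ≤ n′ → n ≡ base d x * n′ + 4 * x →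
  (∀ p i → length (neighbours c p i) < n′) → RainbowCopy c G
-- The hypothesis `1 ≤ n′` excludes zero, so the strict degree bound `n′` becomes the bound `Δ`.
RainbowCopy-sparse {H = H} {n′ = suc Δ} c peels deg 2≤d 1≤x h≤x b≤q s≤b+x _ n≡ nb<
  = Peels-RainbowCopy c peels ≤-refl nb (leaves-bound 2≤d 1≤x n≡ s≤b+x b≤q)
      (RainbowCopy-boundedDegree c (threshold 2≤d 1≤x n≡) H deg nb
        (λ p → partners-bound 2≤d 1≤x n≡ (badPartners-count c _ nb p))
        (embedding-bound 2≤d 1≤x n≡ h≤x))
  where
  nb : ∀ p i → length (neighbours c p i) ≤ Δ
  nb p i = ≤-pred (nb< p i)

theorem1p14 :
    (s t k : ℕ) → 1 ≤ k →
    (a : ℕ) → 1 ≤ a →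
    (F : ℕ → Graph) →
    order (F 1) ≡ s →
    (∀ i → 2 ≤ i → i ≤ a → DeletesAllLeaves (F (i ∸ 1)) (F i)) →
    Leafless (F a) →
    (r : ℕ) → edgeCount (F a) + r ≡ edgeCount (F 1) →
    (d : ℕ) → maxDegree (F a) ≡ d → (2≤d : 2 ≤ d) →
    (b : ℕ) → edgeCount (F 1) ≡ b → b ≤ base d (s ∸ r) →
    ∃ λ gr → IsGallaiRamsey k (F 1) (K t) gr ×
    gr ≤ base d (s ∸ r) ^ (k * t)
    + 4 * (s ∸ r) * (_/_ (base d (s ∸ r) ^ (k * t) ∸ 1) (base d (s ∸ r) ∸ 1) {{base∸1-nonZero (s ∸ r) 2≤d}})
theorem1p14 s t k 1≤k (suc a) _ F refl deletes _ r removed d refl 2≤d b refl b≤q =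
  let gr , unavoidable , least , gr≤ = least-witness (unavoidable? k (F 1) (K t)) (N (k * t))
        (ramsey-unavoidable 1≤k (F 1) N sparse t)
  in gr , record { unavoidable = unavoidable ; least = least } ,
     subst (λ g → gr ≤ q ^ (k * t) + 4 * x * g)
       (sym (geometric-/ q (k * t) {{base∸1-nonZero x 2≤d}})) gr≤
  where
  open ≤-Reasoning

  x q : ℕ
  x = s ∸ r
  q = base d x

  N : ℕ → ℕ
  N = bound q x

  peels : Peels (F 1) (F (suc a))
  peels = Peels-sequence F a deletes

  order≤x : order (F (suc a)) ≤ x
  -- The excess inequality with `removed` substituted gives `order (F (suc a)) + r ≤ s`; thus
  -- `s ∸ r` is a true difference.
  order≤x = m+n≤o⇒m≤o∸n _ (+-cancelˡ-≤ (edgeCount (F (suc a))) _ _ (begin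
    edgeCount (F (suc a)) + (order (F (suc a)) + r)   ≡⟨ cong (edgeCount (F (suc a)) +_) (+-comm (order (F (suc a))) r) ⟩
    edgeCount (F (suc a)) + (r + order (F (suc a)))   ≡⟨ +-assoc (edgeCount (F (suc a))) r _ ⟨
    edgeCount (F (suc a)) + r + order (F (suc a))     ≡⟨ cong (_+ order (F (suc a))) removed ⟩
    edgeCount (F 1) + order (F (suc a))               ≤⟨ Peels-excess peels ⟩
    s + edgeCount (F (suc a))                         ≡⟨ +-comm s _ ⟩
    edgeCount (F (suc a)) + s                         ∎))

  1≤x : 1 ≤ x
  -- A graph of maximum degree at least 2 has a vertex, and its order is at most `x`.
  1≤x = ≤-trans (≤-trans (s≤s z≤n) 2≤d) (≤-trans (maxDegree≤order (F (suc a))) order≤x)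

  order≤ : order (F 1) ≤ edgeCount (F 1) + x
  -- Here `s ≤ r + x`, and the `r` deleted edges are among the edges of `F 1`.
  order≤ = ≤-trans (m≤n+m∸n s r) (+-monoˡ-≤ x (≤-trans (m≤n+m r _) (≤-reflexive removed)))

  1≤q : 1 ≤ q
  1≤q = ≤-trans (s≤s z≤n) (≤-trans (*-monoʳ-≤ 32 (m^n>0 d {{>-nonZero (≤-trans (s≤s z≤n) 2≤d)}} 4)) (m≤n+m _ (2 * d ^ 2 * x)))

  sparse : ∀ m (c : EdgeColouring k (N (suc m))) →
           (∀ p i → length (neighbours c p i) < N m) → RainbowCopy c (F 1)
  sparse m c = RainbowCopy-sparse c peels (degree≤maxDegree (F (suc a))) 2≤d 1≤x order≤x b≤q order≤
                 (bound-positive q x m 1≤q) (bound-suc q x m)
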